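{- Let $\alpha_1,\ldots,\alpha_k,\alpha$ be simple types. (1) Every partial numerical function $f:\mathbb{N}^k\rightharpoonup\mathbb{N}$ that is $(\alpha_1,\ldots,\alpha_k,\alpha)$-definable in the $\lambda\mathrm{Y}$-calculus is $(\alpha_1,\ldots,\alpha_k,\alpha)$-definable in the $\lambda\Omega$-calculus. (2) Every total numerical function $f:\mathbb{N}^k\to\mathbb{N}$ that is $(\alpha_1,\ldots,\alpha_k,\alpha)$-definable in the $\lambda\mathrm{Y}$-calculus is $(\alpha_1,\ldots,\alpha_k,\alpha)$-definable in the typed $\lambda\beta\eta$-calculus.
   Context: Simple types are built from a single ground type $o$ using $\to$. The typed $\lambda\beta\eta$-calculus is taken in Church style (each variable $x^\alpha$ carries its type). For a type $\alpha$ let $\omega_\alpha=(\alpha\to\alpha)\to(\alpha\to\alpha)$ and, for $m\in\mathbb{N}$, let the numeral be $\underline{m}_\alpha=\lambda f^{\alpha\to\alpha}.\lambda x^\alpha.f^m(x)$. The $\lambda\Omega$-calculus is the typed $\lambda\beta\eta$-calculus extended with one constant $\Omega:o$ and no additional conversion rules. The $\lambda\mathrm{Y}$-calculus is the typed $\lambda\beta\eta$-calculus extended with constants $\mathrm{Y}_\sigma:(\sigma\to\sigma)\to\sigma$ for every type $\sigma$, with conversions $f(\mathrm{Y}_\sigma f)=\mathrm{Y}_\sigma f$ (reductions $\mathrm{Y}_\sigma f\to f(\mathrm{Y}_\sigma f)$). Definability: in an extension $\lambda^+$ of the $\lambda\beta\eta$-calculus, a closed term $F:\omega_{\alpha_1}\to\cdots\to\omega_{\alpha_k}\to\omega_\alpha$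 $(\alpha_1,\ldots,\alpha_k,\alpha)$-defines a partial function $f:\mathbb{N}^k\rightharpoonup\mathbb{N}$ iff for all $m_1,\ldots,m_k,m\in\mathbb{N}$: $f(m_1,\ldots,m_k)$ is defined and equal to $m$ if and only if $\vdash_{\lambda^+}F\,\underline{m_1}_{\alpha_1}\cdots\underline{m_k}_{\alpha_k}=\underline{m}_\alpha$. A function is $(\alpha_1,\ldots,\alpha_k,\alpha)$-definable in $\lambda^+$ if some such $F$ exists. -}

module Defs where

open import Data.Nat using (ℕ; zero; suc)
open import Data.List using (List; []; _∷_)
open import Data.Vec using (Vec; []; _∷_)
open import Data.Product using (Σ; _×_)
open import Relation.Binary.PropositionalEquality using (_≡_; trans; sym)

infixr 7 _⇒_
data Ty : Set where
  o   : Ty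
  _⇒_ : Ty → Ty → Ty

Ctx : Set
Ctx = List Ty

infix 4 _∋_
data _∋_ : Ctx → Ty → Set where
  here  : ∀ {Γ σ} → (σ ∷ Γ) ∋ σ
  there : ∀ {Γ σ τ} → Γ ∋ σ → (τ ∷ Γ) ∋ σ

data Tm (C : Ty → Set) (Γ : Ctx) : Ty → Set where
  var : ∀ {σ} → Γ ∋ σ → Tm C Γ σ
  con : ∀ {σ} → C σ → Tm C Γ σ
  lam : ∀ {σ τ} → Tm C (σ ∷ Γ) τ → Tm C Γ (σ ⇒ τ)
  app : ∀ {σ τ} → Tm C Γ (σ ⇒ τ) → Tm C Γ σ → Tm C Γ τ

module _ {C : Ty → Set} where

  Ren : Ctx → Ctx → Set
  Ren Γ Δ = ∀ {σ} → Γ ∋ σ → Δ ∋ σ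

  extR : ∀ {Γ Δ τ} → Ren Γ Δ → Ren (τ ∷ Γ) (τ ∷ Δ)
  extR ρ here      = here
  extR ρ (there x) = there (ρ x)

  rename : ∀ {Γ Δ σ} → Ren Γ Δ → Tm C Γ σ → Tm C Δ σ
  rename ρ (var x)   = var (ρ x)
  rename ρ (con c)   = con c
  rename ρ (lam M)   = lam (rename (extR ρ) M)
  rename ρ (app M N) = app (rename ρ M) (rename ρ N)

  weaken : ∀ {Γ σ τ} → Tm C Γ σ → Tm C (τ ∷ Γ) σ
  weaken = rename there

  Sub : Ctx → Ctx → Set
  Sub Γ Δ = ∀ {σ} → Γ ∋ σ → Tm C Δ σ

  extS : ∀ {Γ Δ τ} → Sub Γ Δ → Sub (τ ∷ Γ) (τ ∷ Δ)
  extS s here      = var here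
  extS s (there x) = weaken (s x)

  subst : ∀ {Γ Δ σ} → Sub Γ Δ → Tm C Γ σ → Tm C Δ σ
  subst s (var x)   = s x
  subst s (con c)   = con c
  subst s (lam M)   = lam (subst (extS s) M)
  subst s (app M N) = app (subst s M) (subst s N)

  _[_] : ∀ {Γ σ τ} → Tm C (σ ∷ Γ) τ → Tm C Γ σ → Tm C Γ τ
  _[_] {Γ} {σ} M N = subst s M
    where
    s : Sub (σ ∷ Γ) Γ
    s here      = N
    s (there x) = var x

Axioms : (Ty → Set) → Set₁
Axioms C = ∀ {Γ σ} → Tm C Γ σ → Tm C Γ σ → Set

data Conv (C : Ty → Set) (Ax : Axioms C) : ∀ {Γ σ} → Tm C Γ σ → Tm C Γ σ → Set where
  c-refl  : ∀ {Γ σ} {M : Tm C Γ σ} → Conv C Ax M M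
  c-sym   : ∀ {Γ σ} {M N : Tm C Γ σ} → Conv C Ax M N → Conv C Ax N M
  c-trans : ∀ {Γ σ} {M N P : Tm C Γ σ} → Conv C Ax M N → Conv C Ax N P → Conv C Ax M P
  c-lam   : ∀ {Γ σ τ} {M N : Tm C (σ ∷ Γ) τ} → Conv C Ax M N → Conv C Ax (lam M) (lam N)
  c-app   : ∀ {Γ σ τ} {M M' : Tm C Γ (σ ⇒ τ)} {N N' : Tm C Γ σ} →
            Conv C Ax M M' → Conv C Ax N N' → Conv C Ax (app M N) (app M' N')
  c-β     : ∀ {Γ σ τ} (M : Tm C (σ ∷ Γ) τ) (N : Tm C Γ σ) → Conv C Ax (app (lam M) N) (M [ N ])
  c-η     : ∀ {Γ σ τ} (M : Tm C Γ (σ ⇒ τ)) → Conv C Ax (lam (app (weaken M) (var here))) M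
  c-ax    : ∀ {Γ σ} {M N : Tm C Γ σ} → Ax M N → Conv C Ax M N

data NoConst : Ty → Set where

data NoAx : Axioms NoConst where

data OmegaConst : Ty → Set where
  Ω : OmegaConst o

data OmegaAx : Axioms OmegaConst where

data YConst : Ty → Set where
  Y : (σ : Ty) → YConst ((σ ⇒ σ) ⇒ σ)

data YAx : Axioms YConst where
  y-ax : ∀ {Γ σ} (f : Tm YConst Γ (σ ⇒ σ)) →
         YAx (app f (app (con (Y σ)) f)) (app (con (Y σ)) f)

ω : Ty → Ty
ω α = (α ⇒ α) ⇒ (α ⇒ α)

iterApp : ∀ {C Γ α} → ℕ → Tm C Γ (α ⇒ α) → Tm C Γ α → Tm C Γ α
iterApp zero    f x = x
iterApp (suc m) f x = app f (iterApp m f x)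

numeral : ∀ {C Γ} (α : Ty) → ℕ → Tm C Γ (ω α)
numeral α m = lam (lam (iterApp m (var (there here)) (var here)))

Arr : ∀ {k} → Vec Ty k → Ty → Ty
Arr []       α = ω α
Arr (β ∷ βs) α = ω β ⇒ Arr βs α

applyNumerals : ∀ {C k} (αs : Vec Ty k) {α : Ty} →
                Tm C [] (Arr αs α) → Vec ℕ k → Tm C [] (ω α)
applyNumerals []       F []       = F
applyNumerals (β ∷ βs) F (m ∷ ms) = applyNumerals βs (app F (numeral β m)) ms

record PartialFun (k : ℕ) : Set₁ where
  field
    graph      : Vec ℕ k → ℕ → Set
    functional : ∀ ms m m' → graph ms m → graph ms m' → m ≡ m'
open PartialFun public

totalGraph : ∀ {k} → (Vec ℕ k → ℕ) → PartialFun k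
totalGraph f = record
  { graph = λ ms m → f ms ≡ m
  ; functional = λ ms m m' p q → trans (sym p) q }

Defines : (C : Ty → Set) (Ax : Axioms C) {k : ℕ} (αs : Vec Ty k) (α : Ty) →
          Tm C [] (Arr αs α) → PartialFun k → Set
Defines C Ax {k} αs α F f =
  ∀ (ms : Vec ℕ k) (m : ℕ) →
    (graph f ms m → Conv C Ax (applyNumerals αs F ms) (numeral α m)) ×
    (Conv C Ax (applyNumerals αs F ms) (numeral α m) → graph f ms m)

Definable : (C : Ty → Set) (Ax : Axioms C) {k : ℕ} (αs : Vec Ty k) (α : Ty) →
            PartialFun k → Set
Definable C Ax αs α f = Σ (Tm C [] (Arr αs α)) (λ F → Defines C Ax αs α F f)

{-# OPTIONS --safe #-}

-- Interpret the calculus in the monotone functions over the lattice false < true, with every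
-- constant equal to ⊥.  Evaluating a closed long normal form at suitable "strict" arguments
-- gives true exactly when the normal form contains no constant.  In this finite model the least
-- fixed point of Y at type σ is already reached after a fixed number h(σ) of iterations, so
-- replacing each Y by λf. fʰ(Y f) in F (with the remaining Y a free constant without axioms)
-- gives a term whose value on numerals m̄ agrees with that of F m̄.  Hence, as soon as F m̄ is a
-- numeral in λY, the axiom-free normal form of the bounded term on m̄ contains no Y.  The
-- remaining Y can then be replaced by anything: by a term built from Ω, or, for total functions,
-- by one built from the ground-type term x z̄ available in λ n̄ f x z̄.
--
-- That the constant-free normal form is the right numeral already in βη is conservativity of λY
-- over βη.  It follows from a Takahashi-style argument: unfolding some occurrences of Y can be
-- completed to unfolding all of them, and unfolding does not change a term whose normal form is
-- constant-free.

module Submission where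

open import Defs
open import Data.Bool using (Bool; true; false; _∨_; if_then_else_; b≤b; f≤t) renaming (_≤_ to _≤ᵇ_)
import Data.Bool.Properties as 𝔹
open import Data.Empty using (⊥-elim)
open import Data.List using (List; []; _∷_; length; filter; cartesianProductWith)
open import Data.List.Membership.Propositional using (_∈_)
open import Data.List.Membership.Propositional.Properties using (∈-cartesianProductWith⁺)
open import Data.List.Properties using (length-filter)
import Data.List.Relation.Unary.All as All
open import Data.List.Relation.Unary.Any using (here; there)
open import Data.Nat using (ℕ; zero; suc; _≤_; _<_; z≤n; s≤s)
import Data.Nat.Properties as ℕ
open import Data.Product using (Σ; _×_; _,_; proj₁; proj₂; ∃-syntax)
open import Data.Sum using (_⊎_; inj₁; inj₂)
open import Data.Vec using (Vec; []; _∷_)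
open import Relation.Binary.Construct.Closure.Equivalence as EqC using (EqClosure)
open import Relation.Binary.Construct.Closure.ReflexiveTransitive using (_◅_; _◅◅_) renaming (ε to nil)
open import Relation.Binary.Construct.Closure.Symmetric using (fwd; bwd)
open import Relation.Binary.PropositionalEquality using (_≡_; refl; sym; trans; cong; cong₂; module ≡-Reasoning)
open import Relation.Nullary using (¬_; Dec; yes; no)
open import Relation.Nullary.Decidable using (map′)
open import Relation.Unary using (Decidable)

-- Simultaneous substitution for variables and constants

ε : ∀ {Γ σ} → [] ∋ σ → Γ ∋ σ
ε ()

infixl 5 _▸_
_▸_ : ∀ {X : Ty → Set} {Γ τ} → (∀ {σ} → Γ ∋ σ → X σ) → X τ → ∀ {σ} → (τ ∷ Γ) ∋ σ → X σ
(r ▸ N) here      = N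
(r ▸ N) (there x) = r x

-- Images of constants may be open terms, so that `Y` can later be replaced by a term in a free
-- ground variable. With `con` for the constants this is ordinary substitution.
csub : ∀ {C C' Γ Δ} → (∀ {σ} → C σ → Tm C' Δ σ) → (∀ {σ} → Γ ∋ σ → Tm C' Δ σ) →
       ∀ {σ} → Tm C Γ σ → Tm C' Δ σ
csub s r (var x)   = r x
csub s r (con c)   = s c
csub s r (lam M)   = lam (csub (λ c → weaken (s c)) (extS r) M)
csub s r (app M N) = app (csub s r M) (csub s r N)

module _ {C : Ty → Set} where

  rename-cong : ∀ {Γ Δ} {ρ ρ' : ∀ {σ} → Γ ∋ σ → Δ ∋ σ} → (∀ {σ} (x : Γ ∋ σ) → ρ x ≡ ρ' x) →
                ∀ {σ} (M : Tm C Γ σ) → rename ρ M ≡ rename ρ' M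
  rename-cong h (var x)   = cong var (h x)
  rename-cong h (con c)   = refl
  rename-cong h (lam M)   = cong lam (rename-cong (λ { here → refl ; (there x) → cong there (h x) }) M)
  rename-cong h (app M N) = cong₂ app (rename-cong h M) (rename-cong h N)

  rename-rename : ∀ {Γ Δ Θ} (ρ' : ∀ {σ} → Δ ∋ σ → Θ ∋ σ) (ρ : ∀ {σ} → Γ ∋ σ → Δ ∋ σ) →
                  ∀ {σ} (M : Tm C Γ σ) → rename ρ' (rename ρ M) ≡ rename (λ x → ρ' (ρ x)) M
  rename-rename ρ' ρ (var x)   = refl
  rename-rename ρ' ρ (con c)   = refl
  rename-rename ρ' ρ (lam M)   = cong lam (trans (rename-rename _ _ M)
    (rename-cong (λ { here → refl ; (there x) → refl }) M))
  rename-rename ρ' ρ (app M N) = cong₂ app (rename-rename ρ' ρ M) (rename-rename ρ' ρ N)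

  rename-extR-weaken : ∀ {Γ Δ τ} (ρ : ∀ {σ} → Γ ∋ σ → Δ ∋ σ) {σ} (M : Tm C Γ σ) →
                       rename (extR {C} {τ = τ} ρ) (weaken M) ≡ weaken (rename ρ M)
  rename-extR-weaken ρ M = trans (rename-rename _ _ M) (sym (rename-rename _ _ M))

  rename-closed : ∀ {Γ Δ} (ρ : ∀ {σ} → Γ ∋ σ → Δ ∋ σ) {σ} (M : Tm C [] σ) →
                  rename ρ (rename ε M) ≡ rename ε M
  rename-closed ρ M = trans (rename-rename _ _ M) (rename-cong (λ ()) M)

module _ {C C' : Ty → Set} where

  csub-cong : ∀ {Γ Δ} {s s' : ∀ {σ} → C σ → Tm C' Δ σ} {r r' : ∀ {σ} → Γ ∋ σ → Tm C' Δ σ} →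
              (∀ {σ} (c : C σ) → s c ≡ s' c) → (∀ {σ} (x : Γ ∋ σ) → r x ≡ r' x) →
              ∀ {σ} (M : Tm C Γ σ) → csub s r M ≡ csub s' r' M
  csub-cong hs hr (var x)   = hr x
  csub-cong hs hr (con c)   = hs c
  csub-cong hs hr (lam M)   = cong lam (csub-cong (λ c → cong weaken (hs c))
    (λ { here → refl ; (there x) → cong weaken (hr x) }) M)
  csub-cong hs hr (app M N) = cong₂ app (csub-cong hs hr M) (csub-cong hs hr N)

  csub-rename : ∀ {Γ Γ' Δ} (s : ∀ {σ} → C σ → Tm C' Δ σ) (r : ∀ {σ} → Γ' ∋ σ → Tm C' Δ σ)
                (ρ : ∀ {σ} → Γ ∋ σ → Γ' ∋ σ) {σ} (M : Tm C Γ σ) →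
                csub s r (rename ρ M) ≡ csub s (λ x → r (ρ x)) M
  csub-rename s r ρ (var x)   = refl
  csub-rename s r ρ (con c)   = refl
  csub-rename s r ρ (lam M)   = cong lam (trans (csub-rename _ _ _ M)
    (csub-cong (λ _ → refl) (λ { here → refl ; (there x) → refl }) M))
  csub-rename s r ρ (app M N) = cong₂ app (csub-rename s r ρ M) (csub-rename s r ρ N)

  rename-csub : ∀ {Γ Δ Δ'} (ρ : ∀ {σ} → Δ ∋ σ → Δ' ∋ σ) (s : ∀ {σ} → C σ → Tm C' Δ σ)
                (r : ∀ {σ} → Γ ∋ σ → Tm C' Δ σ) {σ} (M : Tm C Γ σ) →
                rename ρ (csub s r M) ≡ csub (λ c → rename ρ (s c)) (λ x → rename ρ (r x)) M
  rename-csub ρ s r (var x)   = refl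
  rename-csub ρ s r (con c)   = refl
  rename-csub ρ s r (lam M)   = cong lam (trans (rename-csub _ _ _ M)
    (csub-cong (λ c → rename-extR-weaken ρ (s c))
      (λ { here → refl ; (there x) → rename-extR-weaken ρ (r x) }) M))
  rename-csub ρ s r (app M N) = cong₂ app (rename-csub ρ s r M) (rename-csub ρ s r N)

  csub-weaken : ∀ {Γ Δ τ} (s : ∀ {σ} → C σ → Tm C' Δ σ) (r : ∀ {σ} → Γ ∋ σ → Tm C' Δ σ)
                {σ} (M : Tm C Γ σ) →
                csub (λ c → weaken (s c)) (extS {τ = τ} r) (weaken M) ≡ weaken (csub s r M)
  csub-weaken s r M = trans (csub-rename _ _ _ M) (sym (rename-csub _ _ _ M))

csub-csub : ∀ {C C' C'' Γ Δ Θ} (s' : ∀ {σ} → C' σ → Tm C'' Θ σ) (r' : ∀ {σ} → Δ ∋ σ → Tm C'' Θ σ)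
            (s : ∀ {σ} → C σ → Tm C' Δ σ) (r : ∀ {σ} → Γ ∋ σ → Tm C' Δ σ) {σ} (M : Tm C Γ σ) →
            csub s' r' (csub s r M) ≡ csub (λ c → csub s' r' (s c)) (λ x → csub s' r' (r x)) M
csub-csub s' r' s r (var x)   = refl
csub-csub s' r' s r (con c)   = refl
csub-csub s' r' s r (lam M)   = cong lam (trans (csub-csub _ _ _ _ M)
  (csub-cong (λ c → csub-weaken s' r' (s c))
    (λ { here → refl ; (there x) → csub-weaken s' r' (r x) }) M))
csub-csub s' r' s r (app M N) = cong₂ app (csub-csub s' r' s r M) (csub-csub s' r' s r N)

module _ {C : Ty → Set} where

  csub-id : ∀ {Γ σ} (M : Tm C Γ σ) → csub con var M ≡ M
  csub-id (var x)   = refl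
  csub-id (con c)   = refl
  csub-id (lam M)   = cong lam (trans
    (csub-cong (λ _ → refl) (λ { here → refl ; (there x) → refl }) M) (csub-id M))
  csub-id (app M N) = cong₂ app (csub-id M) (csub-id N)

  subst-csub : ∀ {Γ Δ} (r : ∀ {σ} → Γ ∋ σ → Tm C Δ σ) {σ} (M : Tm C Γ σ) →
               subst r M ≡ csub con r M
  subst-csub r (var x)   = refl
  subst-csub r (con c)   = refl
  subst-csub r (lam M)   = cong lam (subst-csub (extS r) M)
  subst-csub r (app M N) = cong₂ app (subst-csub r M) (subst-csub r N)

  []-csub : ∀ {Γ σ τ} (M : Tm C (σ ∷ Γ) τ) (N : Tm C Γ σ) → M [ N ] ≡ csub con (var ▸ N) M
  []-csub M N = trans (subst-csub _ M)
    (csub-cong (λ _ → refl) (λ { here → refl ; (there x) → refl }) M)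

  csub-▸-weaken : ∀ {Γ σ τ} (M : Tm C Γ τ) (N : Tm C Γ σ) → csub con (var ▸ N) (weaken M) ≡ M
  csub-▸-weaken M N = trans (csub-rename _ _ _ M) (csub-id M)

  weaken-[] : ∀ {Γ σ τ} (M : Tm C Γ τ) (N : Tm C Γ σ) → weaken M [ N ] ≡ M
  weaken-[] M N = trans ([]-csub (weaken M) N) (csub-▸-weaken M N)

csub-[] : ∀ {C C' Γ Δ} (s : ∀ {σ} → C σ → Tm C' Δ σ) (r : ∀ {σ} → Γ ∋ σ → Tm C' Δ σ)
          {σ τ} (M : Tm C (σ ∷ Γ) τ) (N : Tm C Γ σ) →
          csub (λ c → weaken (s c)) (extS r) M [ csub s r N ] ≡ csub s r (M [ N ])
csub-[] s r M N = begin
  csub (λ c → weaken (s c)) (extS r) M [ csub s r N ]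
    ≡⟨ []-csub (csub _ _ M) _ ⟩
  csub con (var ▸ csub s r N) (csub (λ c → weaken (s c)) (extS r) M)
    ≡⟨ csub-csub _ _ _ _ M ⟩
  csub (λ c → csub con (var ▸ csub s r N) (weaken (s c))) (λ x → csub con (var ▸ csub s r N) (extS r x)) M
    ≡⟨ csub-cong (λ c → csub-▸-weaken (s c) _)
         (λ { here → refl ; (there x) → csub-▸-weaken (r x) _ }) M ⟩
  csub s (λ x → csub s r ((var ▸ N) x)) M
    ≡⟨ csub-csub s r con (var ▸ N) M ⟨
  csub s r (csub con (var ▸ N) M)
    ≡⟨ cong (csub s r) ([]-csub M N) ⟨
  csub s r (M [ N ]) ∎
  where open ≡-Reasoning

-- This computes the β-contractum met in `Red-csub`, where a substituted abstraction is first moved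
-- to a larger context and then applied.
rename-csub-[] : ∀ {C C' Γ Δ Θ} (ρ : ∀ {σ} → Δ ∋ σ → Θ ∋ σ) (s : ∀ {σ} → C σ → Tm C' Δ σ)
                 (r : ∀ {σ} → Γ ∋ σ → Tm C' Δ σ)
                 {σ τ} (M : Tm C (σ ∷ Γ) τ) (N : Tm C' Θ σ) →
                 rename (extR {C'} ρ) (csub (λ c → weaken (s c)) (extS r) M) [ N ]
                 ≡ csub (λ c → rename ρ (s c)) ((λ x → rename ρ (r x)) ▸ N) M
rename-csub-[] ρ s r M N = begin
  rename (extR ρ) (csub (λ c → weaken (s c)) (extS r) M) [ N ]
    ≡⟨ []-csub (rename (extR ρ) (csub _ _ M)) N ⟩
  csub con (var ▸ N) (rename (extR ρ) (csub (λ c → weaken (s c)) (extS r) M))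
    ≡⟨ cong (csub con (var ▸ N)) (rename-csub _ _ _ M) ⟩
  csub con (var ▸ N) (csub (λ c → rename (extR ρ) (weaken (s c))) (λ x → rename (extR ρ) (extS r x)) M)
    ≡⟨ csub-csub _ _ _ _ M ⟩
  csub (λ c → csub con (var ▸ N) (rename (extR ρ) (weaken (s c))))
       (λ x → csub con (var ▸ N) (rename (extR ρ) (extS r x))) M
    ≡⟨ csub-cong (λ c → lemma (s c)) (λ { here → refl ; (there x) → lemma (r x) }) M ⟩
  csub (λ c → rename ρ (s c)) ((λ x → rename ρ (r x)) ▸ N) M ∎
  where
  open ≡-Reasoning
  lemma : ∀ {υ} (K : Tm _ _ υ) → csub con (var ▸ N) (rename (extR ρ) (weaken K)) ≡ rename ρ K
  lemma K = trans (cong (csub con (var ▸ N)) (rename-extR-weaken ρ K)) (csub-▸-weaken (rename ρ K) N)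

rename-[] : ∀ {C Γ Δ} (ρ : ∀ {σ} → Γ ∋ σ → Δ ∋ σ) {σ τ} (M : Tm C (σ ∷ Γ) τ) (N : Tm C Γ σ) →
            rename (extR {C} ρ) M [ rename ρ N ] ≡ rename ρ (M [ N ])
rename-[] ρ M N = begin
  rename (extR ρ) M [ rename ρ N ]                      ≡⟨ []-csub (rename (extR ρ) M) _ ⟩
  csub con (var ▸ rename ρ N) (rename (extR ρ) M)       ≡⟨ csub-rename _ _ _ M ⟩
  csub con (λ x → (var ▸ rename ρ N) (extR ρ x)) M
    ≡⟨ csub-cong (λ _ → refl) (λ { here → refl ; (there x) → refl }) M ⟩
  csub con (λ x → rename ρ ((var ▸ N) x)) M             ≡⟨ rename-csub ρ con (var ▸ N) M ⟨
  rename ρ (csub con (var ▸ N) M)                       ≡⟨ cong (rename ρ) ([]-csub M N) ⟨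
  rename ρ (M [ N ])                                    ∎
  where open ≡-Reasoning

-- Conversion

≡⇒Conv : ∀ {C} {Ax : Axioms C} {Γ σ} {M N : Tm C Γ σ} → M ≡ N → Conv C Ax M N
≡⇒Conv refl = c-refl

β-≡ : ∀ {C} {Ax : Axioms C} {Γ σ τ} {M : Tm C (σ ∷ Γ) τ} {N : Tm C Γ σ} {P} →
      M [ N ] ≡ P → Conv C Ax (app (lam M) N) P
β-≡ refl = c-β _ _

η-≡ : ∀ {C} {Ax : Axioms C} {Γ σ τ} {M : Tm C Γ (σ ⇒ τ)} {N} →
      N ≡ weaken M → Conv C Ax (lam (app N (var here))) M
η-≡ refl = c-η _

rename-Conv : ∀ {C} {Ax : Axioms C} →
              (∀ {Γ Δ σ} {M N : Tm C Γ σ} (ρ : ∀ {τ} → Γ ∋ τ → Δ ∋ τ) → Ax M N → Ax (rename ρ M) (rename ρ N)) →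
              ∀ {Γ Δ σ} {M N : Tm C Γ σ} (ρ : ∀ {τ} → Γ ∋ τ → Δ ∋ τ) →
              Conv C Ax M N → Conv C Ax (rename ρ M) (rename ρ N)
rename-Conv h ρ c-refl        = c-refl
rename-Conv h ρ (c-sym p)     = c-sym (rename-Conv h ρ p)
rename-Conv h ρ (c-trans p q) = c-trans (rename-Conv h ρ p) (rename-Conv h ρ q)
rename-Conv h ρ (c-lam p)     = c-lam (rename-Conv h (extR ρ) p)
rename-Conv h ρ (c-app p q)   = c-app (rename-Conv h ρ p) (rename-Conv h ρ q)
rename-Conv h ρ (c-β M N)     = β-≡ (rename-[] ρ M N)
rename-Conv h ρ (c-η M)       = η-≡ (rename-extR-weaken ρ M)
rename-Conv h ρ (c-ax a)      = c-ax (h ρ a)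

csub-Conv : ∀ {C C'} {Ax : Axioms C} {Ax' : Axioms C'} →
            (∀ {Γ σ} {M N : Tm C Γ σ} → ¬ Ax M N) →
            ∀ {Γ Δ σ} {M N : Tm C Γ σ} (s : ∀ {τ} → C τ → Tm C' Δ τ) (r : ∀ {τ} → Γ ∋ τ → Tm C' Δ τ) →
            Conv C Ax M N → Conv C' Ax' (csub s r M) (csub s r N)
csub-Conv h s r c-refl        = c-refl
csub-Conv h s r (c-sym p)     = c-sym (csub-Conv h s r p)
csub-Conv h s r (c-trans p q) = c-trans (csub-Conv h s r p) (csub-Conv h s r q)
csub-Conv h s r (c-lam p)     = c-lam (csub-Conv h _ _ p)
csub-Conv h s r (c-app p q)   = c-app (csub-Conv h s r p) (csub-Conv h s r q)
csub-Conv h s r (c-β M N)     = β-≡ (csub-[] s r M N)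
csub-Conv h s r (c-η M)       = η-≡ (csub-weaken s r M)
csub-Conv h s r (c-ax a)      = ⊥-elim (h a)

data FreeAx (C : Ty → Set) : Axioms C where

infix 3 _≈_
_≈_ : ∀ {C Γ σ} → Tm C Γ σ → Tm C Γ σ → Set
_≈_ {C} = Conv C (FreeAx C)

-- Axiom-free conversion maps into conversion under any axioms along every substitution, in
-- particular along the identity.
≈⇒Conv : ∀ {C} {Ax : Axioms C} {Γ σ} {M N : Tm C Γ σ} → M ≈ N → Conv C Ax M N
≈⇒Conv {M = M} {N} p = c-trans (≡⇒Conv (sym (csub-id M)))
  (c-trans (csub-Conv (λ ()) con var p) (≡⇒Conv (csub-id N)))

rename-≈ : ∀ {C Γ Δ σ} {M N : Tm C Γ σ} (ρ : ∀ {τ} → Γ ∋ τ → Δ ∋ τ) → M ≈ N → rename ρ M ≈ rename ρ N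
rename-≈ = rename-Conv (λ _ ())

-- Replacing constants by closed terms

cmap : ∀ {C C'} → (∀ {σ} → C σ → Tm C' [] σ) → ∀ {Γ σ} → Tm C Γ σ → Tm C' Γ σ
cmap s (var x)   = var x
cmap s (con c)   = rename ε (s c)
cmap s (lam M)   = lam (cmap s M)
cmap s (app M N) = app (cmap s M) (cmap s N)

noConst : ∀ {C Γ σ} → NoConst σ → Tm C Γ σ
noConst ()

embed : ∀ {C Γ σ} → Tm NoConst Γ σ → Tm C Γ σ
embed = cmap noConst

cmap-csub : ∀ {C C'} (s : ∀ {σ} → C σ → Tm C' [] σ) {Γ σ} (M : Tm C Γ σ) →
            cmap s M ≡ csub (λ c → rename ε (s c)) var M
cmap-csub s (var x)   = refl
cmap-csub s (con c)   = refl
cmap-csub s (lam M)   = cong lam (trans (cmap-csub s M)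
  (csub-cong (λ c → sym (rename-closed there (s c))) (λ { here → refl ; (there x) → refl }) M))
cmap-csub s (app M N) = cong₂ app (cmap-csub s M) (cmap-csub s N)

-- Two pointwise equal renamings are carried along because `extR` takes the signature as a
-- parameter: its instances at `C` and `C'` agree only pointwise.
cmap-rename : ∀ {C C'} (s : ∀ {σ} → C σ → Tm C' [] σ) {Γ Δ} {ρ ρ' : ∀ {σ} → Γ ∋ σ → Δ ∋ σ} →
              (∀ {σ} (x : Γ ∋ σ) → ρ x ≡ ρ' x) →
              ∀ {σ} (M : Tm C Γ σ) → cmap s (rename ρ M) ≡ rename ρ' (cmap s M)
cmap-rename s h (var x)   = cong var (h x)
cmap-rename s h (con c)   = sym (rename-closed _ (s c))
cmap-rename s h (lam M)   =
  cong lam (cmap-rename s (λ { here → refl ; (there x) → cong there (h x) }) M)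
cmap-rename s h (app M N) = cong₂ app (cmap-rename s h M) (cmap-rename s h N)

cmap-∘ : ∀ {C C' C''} {s' : ∀ {σ} → C' σ → Tm C'' [] σ} {s : ∀ {σ} → C σ → Tm C' [] σ}
         {t : ∀ {σ} → C σ → Tm C'' [] σ} → (∀ {σ} (c : C σ) → cmap s' (s c) ≡ t c) →
         ∀ {Γ σ} (M : Tm C Γ σ) → cmap s' (cmap s M) ≡ cmap t M
cmap-∘ h (var x)   = refl
cmap-∘ {s' = s'} {s} h (con c) = trans (cmap-rename s' (λ ()) (s c)) (cong (rename ε) (h c))
cmap-∘ h (lam M)   = cong lam (cmap-∘ h M)
cmap-∘ h (app M N) = cong₂ app (cmap-∘ h M) (cmap-∘ h N)

cmap-id : ∀ {C Γ σ} (M : Tm C Γ σ) → cmap con M ≡ M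
cmap-id (var x)   = refl
cmap-id (con c)   = refl
cmap-id (lam M)   = cong lam (cmap-id M)
cmap-id (app M N) = cong₂ app (cmap-id M) (cmap-id N)

cmap-embed : ∀ {C C' : Ty → Set} (s : ∀ {σ} → C σ → Tm C' [] σ) {Γ σ} (M : Tm NoConst Γ σ) →
             cmap s (embed M) ≡ embed M
cmap-embed s = cmap-∘ {s' = s} {noConst} {noConst} (λ ())

cmap-Conv : ∀ {C C'} {Ax : Axioms C} {Ax' : Axioms C'} →
            (∀ {Γ σ} {M N : Tm C Γ σ} → ¬ Ax M N) →
            (s : ∀ {σ} → C σ → Tm C' [] σ) → ∀ {Γ σ} {M N : Tm C Γ σ} →
            Conv C Ax M N → Conv C' Ax' (cmap s M) (cmap s N)
cmap-Conv h s {M = M} {N} p = c-trans (≡⇒Conv (cmap-csub s M))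
  (c-trans (csub-Conv h (λ c → rename ε (s c)) var p) (≡⇒Conv (sym (cmap-csub s N))))

cmap-≈ : ∀ {C C'} {Ax' : Axioms C'} (s : ∀ {σ} → C σ → Tm C' [] σ) {Γ σ} {M N : Tm C Γ σ} →
         M ≈ N → Conv C' Ax' (cmap s M) (cmap s N)
cmap-≈ = cmap-Conv (λ ())

-- Long normal forms

mutual
  data Nf {C : Ty → Set} {Γ : Ctx} : ∀ {σ} → Tm C Γ σ → Set where
    lam : ∀ {σ τ} {M : Tm C (σ ∷ Γ) τ} → Nf M → Nf (lam M)
    ne  : {M : Tm C Γ o} → Ne M → Nf M

  data Ne {C : Ty → Set} {Γ : Ctx} : ∀ {σ} → Tm C Γ σ → Set where
    var : ∀ {σ} (x : Γ ∋ σ) → Ne (var x)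
    con : ∀ {σ} (c : C σ) → Ne (con c)
    app : ∀ {σ τ} {M : Tm C Γ (σ ⇒ τ)} {N : Tm C Γ σ} → Ne M → Nf N → Ne (app M N)

module _ {C : Ty → Set} where

  mutual
    rename-Nf : ∀ {Γ Δ} (ρ : ∀ {σ} → Γ ∋ σ → Δ ∋ σ) {σ} {M : Tm C Γ σ} → Nf M → Nf (rename ρ M)
    rename-Nf ρ (lam n) = lam (rename-Nf (extR ρ) n)
    rename-Nf ρ (ne n)  = ne (rename-Ne ρ n)

    rename-Ne : ∀ {Γ Δ} (ρ : ∀ {σ} → Γ ∋ σ → Δ ∋ σ) {σ} {M : Tm C Γ σ} → Ne M → Ne (rename ρ M)
    rename-Ne ρ (var x)   = var (ρ x)
    rename-Ne ρ (con c)   = con c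
    rename-Ne ρ (app m n) = app (rename-Ne ρ m) (rename-Nf ρ n)

  -- A Kripke logical predicate: quantifying over renamings lets `reify` apply a term to a fresh
  -- variable.
  Red : ∀ σ {Γ} → Tm C Γ σ → Set
  Red o       {Γ} M = ∃[ N ] Ne N × M ≈ N
  Red (σ ⇒ τ) {Γ} M = ∀ {Δ} (ρ : ∀ {υ} → Γ ∋ υ → Δ ∋ υ) {N : Tm C Δ σ} → Red σ N → Red τ (app (rename ρ M) N)

  Red-≈ : ∀ σ {Γ} {M N : Tm C Γ σ} → M ≈ N → Red σ N → Red σ M
  Red-≈ o       p (N , n , q) = N , n , c-trans p q
  Red-≈ (σ ⇒ τ) p R ρ S       = Red-≈ τ (c-app (rename-≈ ρ p) c-refl) (R ρ S)

  Red-rename : ∀ σ {Γ Δ} (ρ : ∀ {τ} → Γ ∋ τ → Δ ∋ τ) {M : Tm C Γ σ} → Red σ M → Red σ (rename ρ M)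
  Red-rename o       ρ (N , n , q)  = rename ρ N , rename-Ne ρ n , rename-≈ ρ q
  Red-rename (σ ⇒ τ) ρ {M} R ρ' S =
    Red-≈ τ (c-app (≡⇒Conv (rename-rename ρ' ρ M)) c-refl) (R (λ x → ρ' (ρ x)) S)

  mutual
    reify : ∀ σ {Γ} {M : Tm C Γ σ} → Red σ M → ∃[ N ] Nf N × M ≈ N
    reify o       (N , n , p) = N , ne n , p
    reify (σ ⇒ τ) {M = M} R   with reify τ (R there (reflect σ (var here)))
    ... | N , n , p = lam N , lam n , c-trans (c-sym (c-η M)) (c-lam p)

    reflect : ∀ σ {Γ} {M : Tm C Γ σ} → Ne M → Red σ M
    reflect o       n     = _ , n , c-refl
    reflect (σ ⇒ τ) m ρ S with reify σ S
    ... | N , n , p = Red-≈ τ (c-app c-refl p) (reflect τ (app (rename-Ne ρ m) n))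

  -- The fundamental lemma of the logical predicate. Without axioms a constant is just a neutral
  -- head, so it is reflected like a variable.
  Red-csub : ∀ {Γ Δ σ} (M : Tm C Γ σ) {r : ∀ {τ} → Γ ∋ τ → Tm C Δ τ} →
             (∀ {τ} (x : Γ ∋ τ) → Red τ (r x)) → Red σ (csub con r M)
  Red-csub (var x) R = R x
  Red-csub (con c) R = reflect _ (con c)
  Red-csub (lam {τ = τ} M) {r} R ρ {N} S =
    Red-≈ τ (β-≡ (rename-csub-[] ρ con r M N))
      (Red-csub M λ { here → S ; (there x) → Red-rename _ ρ (R x) })
  Red-csub {Δ = Δ} (app {τ = τ} M N) {r} R =
    Red-≈ τ (c-app (≡⇒Conv (trans (sym (csub-id (csub con r M))) (sym (rename-id _)))) c-refl)
      (Red-csub M R (λ x → x) (Red-csub N R))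
    where
    rename-id : ∀ {σ} (K : Tm C Δ σ) → rename (λ x → x) K ≡ csub con var K
    rename-id K = trans (sym (csub-id _)) (csub-rename con var (λ x → x) K)

  normalise : ∀ {Γ σ} (M : Tm C Γ σ) → ∃[ N ] Nf N × M ≈ N
  normalise M with reify _ (Red-csub M (λ x → reflect _ (var x)))
  ... | N , n , p = N , n , c-trans (≡⇒Conv (sym (csub-id M))) p

-- The monotone model over the two-point lattice

infix 4 _⊢_⊑_ _⊢_≃_
mutual
  D : Ty → Set
  D o       = Bool
  D (σ ⇒ τ) = Σ (D σ → D τ) λ f → ∀ {d e} → σ ⊢ d ⊑ e → τ ⊢ f d ⊑ f e

  _⊢_⊑_ : (σ : Ty) → D σ → D σ → Set
  o     ⊢ a ⊑ b = a ≤ᵇ b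
  σ ⇒ τ ⊢ f ⊑ g = ∀ d → τ ⊢ proj₁ f d ⊑ proj₁ g d

⊑-refl : ∀ σ {d} → σ ⊢ d ⊑ d
⊑-refl o         = 𝔹.≤-refl
⊑-refl (σ ⇒ τ) d = ⊑-refl τ

⊑-trans : ∀ σ {d e k} → σ ⊢ d ⊑ e → σ ⊢ e ⊑ k → σ ⊢ d ⊑ k
⊑-trans o       p q   = 𝔹.≤-trans p q
⊑-trans (σ ⇒ τ) p q d = ⊑-trans τ (p d) (q d)

-- Equality of the model is equivalence in the order, since elements of function type carry
-- monotonicity proofs and are to be compared by their values only.
_⊢_≃_ : (σ : Ty) → D σ → D σ → Set
σ ⊢ d ≃ e = σ ⊢ d ⊑ e × σ ⊢ e ⊑ d

≃-refl : ∀ σ {d} → σ ⊢ d ≃ d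
≃-refl σ = ⊑-refl σ , ⊑-refl σ

≃-sym : ∀ σ {d e} → σ ⊢ d ≃ e → σ ⊢ e ≃ d
≃-sym σ (p , q) = q , p

≃-trans : ∀ σ {d e k} → σ ⊢ d ≃ e → σ ⊢ e ≃ k → σ ⊢ d ≃ k
≃-trans σ (p , p') (q , q') = ⊑-trans σ p q , ⊑-trans σ q' p'

≃-app : ∀ σ τ (f g : D (σ ⇒ τ)) {d e} → σ ⇒ τ ⊢ f ≃ g → σ ⊢ d ≃ e → τ ⊢ proj₁ f d ≃ proj₁ g e
≃-app σ τ f g {d} {e} (p , p') (q , q') =
  ⊑-trans τ (proj₂ f q) (p e) , ⊑-trans τ (p' e) (proj₂ f q')

⊥ᴰ : ∀ σ → D σ
⊥ᴰ o       = false
⊥ᴰ (σ ⇒ τ) = (λ _ → ⊥ᴰ τ) , λ _ → ⊑-refl τ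

⊥-min : ∀ σ d → σ ⊢ ⊥ᴰ σ ⊑ d
⊥-min o       d   = 𝔹.≤-minimum d
⊥-min (σ ⇒ τ) f d = ⊥-min τ (proj₁ f d)

mutual
  join : ∀ σ → D σ → D σ → D σ
  join o       a b = a ∨ b
  join (σ ⇒ τ) f g = (λ d → join τ (proj₁ f d) (proj₁ g d)) , λ p →
    join-lub τ (⊑-trans τ (proj₂ f p) (join-inˡ τ _ _)) (⊑-trans τ (proj₂ g p) (join-inʳ τ _ _))

  join-inˡ : ∀ σ d e → σ ⊢ d ⊑ join σ d e
  join-inˡ o       false b = 𝔹.≤-minimum b
  join-inˡ o       true  b = b≤b
  join-inˡ (σ ⇒ τ) f g d   = join-inˡ τ _ _

  join-inʳ : ∀ σ d e → σ ⊢ e ⊑ join σ d e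
  join-inʳ o       false b = b≤b
  join-inʳ o       true  b = 𝔹.≤-maximum b
  join-inʳ (σ ⇒ τ) f g d   = join-inʳ τ _ _

  join-lub : ∀ σ {d e k} → σ ⊢ d ⊑ k → σ ⊢ e ⊑ k → σ ⊢ join σ d e ⊑ k
  join-lub o {false} p q     = q
  join-lub o {true}  p q     = p
  join-lub (σ ⇒ τ)   p q d   = join-lub τ (p d) (q d)

-- Finiteness of the model, up to order equivalence

record Finite (σ : Ty) : Set where
  field
    elements : List (D σ)
    complete : ∀ d → ∃[ e ] e ∈ elements × σ ⊢ e ≃ d
    _⊑?_     : ∀ d e → Dec (σ ⊢ d ⊑ e)

module _ {σ τ : Ty} (𝓢 : Finite σ) (𝓣 : Finite τ) where
  private
    module S = Finite 𝓢
    module T = Finite 𝓣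

  -- The step function of domain theory: the least monotone function whose value at `e` is at least
  -- `t`.
  step-fun : D σ → D τ → D σ → D τ
  step-fun e t d with e S.⊑? d
  ... | yes _ = t
  ... | no  _ = ⊥ᴰ τ

  step-mono : ∀ e t {d d'} → σ ⊢ d ⊑ d' → τ ⊢ step-fun e t d ⊑ step-fun e t d'
  step-mono e t {d} {d'} p with e S.⊑? d | e S.⊑? d'
  ... | yes _ | yes _ = ⊑-refl τ
  ... | yes q | no ¬r = ⊥-elim (¬r (⊑-trans σ q p))
  ... | no _  | _     = ⊥-min τ _

  step : D σ → D τ → D (σ ⇒ τ)
  step e t = step-fun e t , step-mono e t

  step-⊑ : ∀ f {e t} → τ ⊢ t ⊑ proj₁ f e → σ ⇒ τ ⊢ step e t ⊑ f
  step-⊑ f {e} p d with e S.⊑? d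
  ... | yes q = ⊑-trans τ p (proj₂ f q)
  ... | no _  = ⊥-min τ _

  step-value : ∀ e t → τ ⊢ t ⊑ step-fun e t e
  step-value e t with e S.⊑? e
  ... | yes _ = ⊑-refl τ
  ... | no ¬p = ⊥-elim (¬p (⊑-refl σ))

  stepJoins : List (D σ) → List (D (σ ⇒ τ))
  stepJoins []       = ⊥ᴰ (σ ⇒ τ) ∷ []
  stepJoins (e ∷ es) = cartesianProductWith (λ t → join (σ ⇒ τ) (step e t)) T.elements (stepJoins es)

  -- A monotone function is the join of the steps from `e` to `f e`. Choosing for `t` the listed
  -- representative of `f e` keeps the join below `f` and makes it reach `f` at every listed
  -- argument.
  stepJoins-approx : ∀ f es → ∃[ g ] g ∈ stepJoins es × σ ⇒ τ ⊢ g ⊑ f ×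
                     (∀ {e} → e ∈ es → τ ⊢ proj₁ f e ⊑ proj₁ g e)
  stepJoins-approx f []       = _ , here refl , ⊥-min (σ ⇒ τ) f , λ ()
  stepJoins-approx f (e ∷ es) with stepJoins-approx f es | T.complete (proj₁ f e)
  ... | g , g∈ , g⊑f , f⊑g | t , t∈ , t⊑ , ⊒t =
    join (σ ⇒ τ) (step e t) g ,
    ∈-cartesianProductWith⁺ (λ t → join (σ ⇒ τ) (step e t)) t∈ g∈ ,
    join-lub (σ ⇒ τ) {step e t} {g} {f} (step-⊑ f t⊑) g⊑f ,
    λ { (here refl) → ⊑-trans τ ⊒t (⊑-trans τ (step-value e t) (join-inˡ τ _ _))
      ; (there e∈)  → ⊑-trans τ (f⊑g e∈) (join-inʳ τ _ _) }

  Finite-⇒ : Finite (σ ⇒ τ)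
  Finite-⇒ = record
    { elements = stepJoins S.elements
    ; complete = λ f → let g , g∈ , g⊑f , f⊑g = stepJoins-approx f S.elements in
        g , g∈ , g⊑f , below f g f⊑g
    ; _⊑?_ = λ f g → map′ (λ all → below f g (All.lookup all)) (λ p → All.tabulate (λ {d} _ → p d))
        (All.all? (λ d → proj₁ f d T.⊑? proj₁ g d) S.elements)
    }
    where
    -- Comparing values at representatives suffices, because monotone functions respect equivalence.
    below : ∀ f g → (∀ {e} → e ∈ S.elements → τ ⊢ proj₁ f e ⊑ proj₁ g e) → σ ⇒ τ ⊢ f ⊑ g
    below f g p d with S.complete d
    ... | e , e∈ , e⊑d , d⊑e = ⊑-trans τ (proj₂ f d⊑e) (⊑-trans τ (p e∈) (proj₂ g e⊑d))

finite : ∀ σ → Finite σ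
finite o = record
  { elements = false ∷ true ∷ []
  ; complete = λ { false → false , here refl , ≃-refl o ; true → true , there (here refl) , ≃-refl o }
  ; _⊑?_     = 𝔹._≤?_ }
finite (σ ⇒ τ) = Finite-⇒ (finite σ) (finite τ)

-- Stabilisation of the iteration from bottom

module _ {A : Set} {P Q : A → Set} (P? : Decidable P) (Q? : Decidable Q) (P⊆Q : ∀ {x} → P x → Q x) where

  length-filter-mono : ∀ xs → length (filter P? xs) ≤ length (filter Q? xs)
  length-filter-mono []       = z≤n
  length-filter-mono (x ∷ xs) with ih ← length-filter-mono xs | P? x | Q? x
  ... | yes _ | yes _ = s≤s ih
  ... | yes p | no ¬q = ⊥-elim (¬q (P⊆Q p))
  ... | no _  | yes _ = ℕ.m≤n⇒m≤1+n ih
  ... | no _  | no _  = ih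

  length-filter-strict : ∀ {x xs} → x ∈ xs → ¬ P x → Q x → length (filter P? xs) < length (filter Q? xs)
  length-filter-strict {x} {x ∷ xs} (here refl) ¬p q with P? x | Q? x
  ... | yes p | _     = ⊥-elim (¬p p)
  ... | no _  | yes _ = s≤s (length-filter-mono xs)
  ... | no _  | no ¬q = ⊥-elim (¬q q)
  length-filter-strict {xs = y ∷ xs} (there x∈) ¬p q
    with ih ← length-filter-strict x∈ ¬p q | P? y | Q? y
  ... | yes _  | yes _  = s≤s ih
  ... | yes p' | no ¬q' = ⊥-elim (¬q' (P⊆Q p'))
  ... | no _   | yes _  = ℕ.m≤n⇒m≤1+n ih
  ... | no _   | no _   = ih

module _ (σ : Ty) where
  open Finite (finite σ)

  iterᴰ : D (σ ⇒ σ) → ℕ → D σ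
  iterᴰ f zero    = ⊥ᴰ σ
  iterᴰ f (suc n) = proj₁ f (iterᴰ f n)

  iterᴰ-ascending : ∀ f n → σ ⊢ iterᴰ f n ⊑ iterᴰ f (suc n)
  iterᴰ-ascending f zero    = ⊥-min σ _
  iterᴰ-ascending f (suc n) = proj₂ f (iterᴰ-ascending f n)

  rank : D σ → ℕ
  rank d = length (filter (_⊑? d) elements)

  -- The listed representative of `e` is counted in the rank of `e` but not in that of `d`.
  rank-strict : ∀ {d e} → σ ⊢ d ⊑ e → ¬ σ ⊢ e ⊑ d → rank d < rank e
  rank-strict {d} {e} p ¬q with complete e
  ... | e' , e'∈ , e'⊑e , e⊑e' =
    length-filter-strict (_⊑? d) (_⊑? e) (λ r → ⊑-trans σ r p) e'∈
      (λ r → ¬q (⊑-trans σ e⊑e' r)) e'⊑e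

  -- Each strict step of the ascending chain raises the rank by at least one, and once a step is not
  -- strict, monotonicity of `f` keeps all later ones from being strict.
  stable-or-high : ∀ f n → σ ⊢ iterᴰ f (suc n) ⊑ iterᴰ f n ⊎ n ≤ rank (iterᴰ f n)
  stable-or-high f zero    = inj₂ z≤n
  stable-or-high f (suc n) with iterᴰ f (suc n) ⊑? iterᴰ f n | stable-or-high f n
  ... | yes p | _      = inj₁ (proj₂ f p)
  ... | no ¬p | inj₁ p = ⊥-elim (¬p p)
  ... | no ¬p | inj₂ q = inj₂ (ℕ.≤-trans (s≤s q) (rank-strict (iterᴰ-ascending f n) ¬p))

  -- The number of listed elements bounds every rank; one more step than that rules out the second
  -- alternative of `stable-or-high`.
  height : ℕ
  height = suc (length elements)

  iterᴰ-fixed : ∀ f → σ ⊢ proj₁ f (iterᴰ f height) ≃ iterᴰ f height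
  iterᴰ-fixed f with stable-or-high f height
  ... | inj₁ p = p , iterᴰ-ascending f height
  ... | inj₂ q = ⊥-elim (ℕ.<⇒≱ (s≤s (length-filter (_⊑? iterᴰ f height) elements)) q)

-- Interpretation of terms and its soundness

Env : Ctx → Set
Env Γ = ∀ {σ} → Γ ∋ σ → D σ

∅ : Env []
∅ ()

module _ {C : Ty → Set} where

  mutual
    eval : (∀ {σ} → C σ → D σ) → ∀ {Γ} → Env Γ → ∀ {σ} → Tm C Γ σ → D σ
    eval I ρ (var x)   = ρ x
    eval I ρ (con c)   = I c
    eval I ρ (lam {σ = σ} M) = (λ d → eval I (_▸_ {D} ρ d) M) , λ p →
      eval-mono I (λ { here → p ; (there {σ = υ} x) → ⊑-refl υ }) M
    eval I ρ (app M N) = proj₁ (eval I ρ M) (eval I ρ N)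

    eval-mono : (I : ∀ {σ} → C σ → D σ) → ∀ {Γ} {ρ ρ' : Env Γ} → (∀ {σ} (x : Γ ∋ σ) → σ ⊢ ρ x ⊑ ρ' x) →
                ∀ {σ} (M : Tm C Γ σ) → σ ⊢ eval I ρ M ⊑ eval I ρ' M
    eval-mono I p (var x)   = p x
    eval-mono I p (con {σ} c) = ⊑-refl σ
    eval-mono I p (lam M) d = eval-mono I (λ { here → ⊑-refl _ ; (there x) → p x }) M
    eval-mono I {ρ' = ρ'} p {τ} (app M N) =
      ⊑-trans τ (eval-mono I p M (eval I _ N)) (proj₂ (eval I ρ' M) (eval-mono I p N))

  eval-rename : (I : ∀ {σ} → C σ → D σ) → ∀ {Γ Δ} {ρ : ∀ {σ} → Γ ∋ σ → Δ ∋ σ} {e : Env Γ} {e' : Env Δ} →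
                (∀ {σ} (x : Γ ∋ σ) → σ ⊢ e' (ρ x) ≃ e x) →
                ∀ {σ} (M : Tm C Γ σ) → σ ⊢ eval I e' (rename ρ M) ≃ eval I e M
  eval-rename I h (var x)   = h x
  eval-rename I h (con {σ} c) = ≃-refl σ
  eval-rename I {e = e} {e'} h (lam {σ = σ} M) = (λ d → proj₁ (ih d)) , (λ d → proj₂ (ih d))
    where
    ih = λ d → eval-rename I {e = _▸_ {D} e d} {e' = _▸_ {D} e' d} (λ { here → ≃-refl σ ; (there x) → h x }) M
  eval-rename I {e = e} {e'} h {τ} (app {σ} M N) =
    ≃-app σ τ (eval I e' (rename _ M)) (eval I e M) (eval-rename I h M) (eval-rename I h N)

eval-csub : ∀ {C C'} {I : ∀ {σ} → C σ → D σ} {I' : ∀ {σ} → C' σ → D σ} →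
            ∀ {Γ Δ} {s : ∀ {σ} → C σ → Tm C' Δ σ} {r : ∀ {σ} → Γ ∋ σ → Tm C' Δ σ} {e : Env Γ} {e' : Env Δ} →
            (∀ {σ} (c : C σ) → σ ⊢ eval I' e' (s c) ≃ I c) →
            (∀ {σ} (x : Γ ∋ σ) → σ ⊢ eval I' e' (r x) ≃ e x) →
            ∀ {σ} (M : Tm C Γ σ) → σ ⊢ eval I' e' (csub s r M) ≃ eval I e M
eval-csub hs hr (var x) = hr x
eval-csub hs hr (con c) = hs c
eval-csub {I = I} {I'} {s = s} {r} {e} {e'} hs hr (lam {σ = σ} M) =
  (λ d → proj₁ (ih d)) , (λ d → proj₂ (ih d))
  where
  ih = λ d → eval-csub {I = I} {I'} {e = _▸_ {D} e d} {e' = _▸_ {D} e' d}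
    (λ {υ} c → ≃-trans υ (eval-rename I' (λ {υ} x → ≃-refl υ) (s c)) (hs c))
    (λ { here → ≃-refl σ
       ; (there {σ = υ} x) → ≃-trans υ (eval-rename I' (λ {υ} x → ≃-refl υ) (r x)) (hr x) }) M
eval-csub {I = I} {I'} {e = e} {e'} hs hr {τ} (app {σ} M N) =
  ≃-app σ τ (eval I' e' (csub _ _ M)) (eval I e M) (eval-csub hs hr M) (eval-csub hs hr N)

eval-cmap : ∀ {C C'} {I : ∀ {σ} → C σ → D σ} {I' : ∀ {σ} → C' σ → D σ} {s : ∀ {σ} → C σ → Tm C' [] σ} →
            (∀ {σ} (c : C σ) → σ ⊢ eval I' ∅ (s c) ≃ I c) →
            ∀ {σ} (M : Tm C [] σ) → σ ⊢ eval I' ∅ (cmap s M) ≃ eval I ∅ M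
eval-cmap {I = I} {I'} {s} h M rewrite cmap-csub s M =
  eval-csub {I = I} {I'} (λ {υ} c → ≃-trans υ (eval-rename I' (λ ()) (s c)) (h c)) (λ ()) M

eval-Conv : ∀ {C} {Ax : Axioms C} (I : ∀ {σ} → C σ → D σ) →
            (∀ {Γ σ} {M N : Tm C Γ σ} (e : Env Γ) → Ax M N → σ ⊢ eval I e M ≃ eval I e N) →
            ∀ {Γ σ} {M N : Tm C Γ σ} (e : Env Γ) → Conv C Ax M N → σ ⊢ eval I e M ≃ eval I e N
eval-Conv I h {σ = σ} e c-refl        = ≃-refl σ
eval-Conv I h {σ = σ} e (c-sym p)     = ≃-sym σ (eval-Conv I h e p)
eval-Conv I h {σ = σ} e (c-trans p q) = ≃-trans σ (eval-Conv I h e p) (eval-Conv I h e q)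
eval-Conv I h e (c-lam p)     =
  (λ d → proj₁ (eval-Conv I h (_▸_ {D} e d) p)) , (λ d → proj₂ (eval-Conv I h (_▸_ {D} e d) p))
eval-Conv I h e (c-app {σ = σ} {τ} {M} {M'} p q) =
  ≃-app σ τ (eval I e M) (eval I e M') (eval-Conv I h e p) (eval-Conv I h e q)
eval-Conv I h {σ = τ} e (c-β M N) rewrite []-csub M N =
  ≃-sym τ (eval-csub (λ {υ} _ → ≃-refl υ) (λ { {υ} here → ≃-refl υ ; {υ} (there x) → ≃-refl υ }) M)
eval-Conv I h e (c-η {σ = σ} {τ} M) =
  (λ d → proj₁ (w d)) , (λ d → proj₂ (w d))
  where
  w : ∀ d → τ ⊢ proj₁ (eval I (_▸_ {D} e d) (weaken M)) d ≃ proj₁ (eval I e M) d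
  w d = ≃-app σ τ (eval I (_▸_ {D} e d) (weaken M)) (eval I e M) (eval-rename I (λ {υ} x → ≃-refl υ) M) (≃-refl σ)
eval-Conv I h e (c-ax a) = h e a

-- Detecting constants

-- Fully applied, strict σ is true iff all arguments are total, and totality is tested at strict
-- arguments; so a single ⊥ anywhere in a long normal form propagates to the root.
mutual
  strict : ∀ σ → D σ
  strict o       = true
  strict (σ ⇒ τ) = (λ d → if total σ d then strict τ else ⊥ᴰ τ) , λ p → guard τ (total-mono σ p)

  total : ∀ σ → D σ → Bool
  total o       b = b
  total (σ ⇒ τ) f = total τ (proj₁ f (strict σ))

  total-mono : ∀ σ {d e} → σ ⊢ d ⊑ e → total σ d ≤ᵇ total σ e
  total-mono o       p = p
  total-mono (σ ⇒ τ) p = total-mono τ (p (strict σ))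

  guard : ∀ τ {a b} → a ≤ᵇ b →
          τ ⊢ (if a then strict τ else ⊥ᴰ τ) ⊑ (if b then strict τ else ⊥ᴰ τ)
  guard τ f≤t = ⊥-min τ _
  guard τ b≤b = ⊑-refl τ

total-⊥ : ∀ σ → total σ (⊥ᴰ σ) ≡ false
total-⊥ o       = refl
total-⊥ (σ ⇒ τ) = total-⊥ τ

total-≃ : ∀ σ {d e} → σ ⊢ d ≃ e → total σ d ≡ total σ e
total-≃ σ (p , q) = 𝔹.≤-antisym (total-mono σ p) (total-mono σ q)

total-cmap : ∀ {C C'} {I : ∀ {σ} → C σ → D σ} {I' : ∀ {σ} → C' σ → D σ} {s : ∀ {σ} → C σ → Tm C' [] σ} →
             (∀ {σ} (c : C σ) → σ ⊢ eval I' ∅ (s c) ≃ I c) →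
             ∀ {σ} (M : Tm C [] σ) → total σ (eval I' ∅ (cmap s M)) ≡ total σ (eval I ∅ M)
total-cmap {I = I} {I'} h {σ} M = total-≃ σ (eval-cmap {I = I} {I'} h M)

total-Conv : ∀ {C} {Ax : Axioms C} (I : ∀ {σ} → C σ → D σ) →
             (∀ {Γ σ} {M N : Tm C Γ σ} (e : Env Γ) → Ax M N → σ ⊢ eval I e M ≃ eval I e N) →
             ∀ {σ} {M N : Tm C [] σ} → Conv C Ax M N → total σ (eval I ∅ M) ≡ total σ (eval I ∅ N)
total-Conv I h {σ} p = total-≃ σ (eval-Conv I h ∅ p)

⟦_⟧⊥ : ∀ {C σ} → Tm C [] σ → D σ
⟦_⟧⊥ = eval (λ {σ} _ → ⊥ᴰ σ) ∅

-- The witness is a term over the empty signature, so that it can be embedded again into any other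
-- calculus.
data ConstFree {C Γ σ} (M : Tm C Γ σ) : Set where
  pure : (P : Tm NoConst Γ σ) → embed P ≡ M → ConstFree M

module _ {C : Ty → Set} where
  private
    ev : ∀ {Γ} → Env Γ → ∀ {σ} → Tm C Γ σ → D σ
    ev = eval (λ {σ} _ → ⊥ᴰ σ)

  mutual
    -- The failing alternative also exhibits a constant of the signature. Over the empty signature
    -- it is therefore absurd, which is how `pure⇒total` gets its value.
    nf-total : ∀ {Γ} (e : Env Γ) → (∀ {σ} (x : Γ ∋ σ) → e x ≡ strict σ) →
               ∀ {σ} {M : Tm C Γ σ} → Nf M →
               (ConstFree M × total σ (ev e M) ≡ true) ⊎ (Σ Ty C × total σ (ev e M) ≡ false)
    nf-total e h (lam n) with nf-total (_▸_ {D} e (strict _)) (λ { here → refl ; (there x) → h x }) n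
    ... | inj₁ (pure P refl , t) = inj₁ (pure (lam P) refl , t)
    ... | inj₂ t                 = inj₂ t
    nf-total e h (ne n) with ne-strict e h n
    ... | inj₁ t = inj₁ t
    ... | inj₂ t = inj₂ t

    ne-strict : ∀ {Γ} (e : Env Γ) → (∀ {σ} (x : Γ ∋ σ) → e x ≡ strict σ) →
                ∀ {σ} {M : Tm C Γ σ} → Ne M →
                (ConstFree M × ev e M ≡ strict σ) ⊎ (Σ Ty C × ev e M ≡ ⊥ᴰ σ)
    ne-strict e h (var x) = inj₁ (pure (var x) refl , h x)
    ne-strict e h (con c) = inj₂ ((_ , c) , refl)
    ne-strict e h (app {M = M} {N} m n) with ne-strict e h m | nf-total e h n
    ... | inj₂ (c , p) | _ rewrite p = inj₂ (c , refl)
    ... | inj₁ (pure P refl , p) | inj₁ (pure Q refl , q) rewrite p | q = inj₁ (pure (app P Q) refl , refl)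
    -- A strict head tests its argument for totality and collapses to bottom when the test fails.
    ... | inj₁ (pure P refl , p) | inj₂ (c , q) rewrite p | q = inj₂ (c , refl)

  total⇒pure : ∀ {σ} (M : Tm C [] σ) → total σ ⟦ M ⟧⊥ ≡ true → ∃[ P ] M ≈ embed P
  total⇒pure {σ} M t with normalise M
  ... | N , n , p with nf-total ∅ (λ ()) n
  ... | inj₁ (pure P refl , _) = P , p
  ... | inj₂ (_ , f) with () ← trans (sym t) (trans (total-Conv _ (λ _ ()) p) f)

-- Normalisation takes place over the empty signature, where no constant can spoil totality; the
-- value is then transported along `embed`.
pure⇒total : ∀ {C : Ty → Set} (I : ∀ {σ} → C σ → D σ) {σ} (P : Tm NoConst [] σ) →
             total σ (eval I ∅ (embed P)) ≡ true
pure⇒total I {σ} P with normalise P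
... | N , n , p with nf-total ∅ (λ ()) n
... | inj₁ (_ , t) = trans (total-cmap (λ ()) P) (trans (total-Conv _ (λ _ ()) p) t)
... | inj₂ ((_ , ()) , _)

-- Conservativity of λY over the pure calculus

unfold : ∀ {C Γ σ} → C ((σ ⇒ σ) ⇒ σ) → Tm C Γ ((σ ⇒ σ) ⇒ σ)
unfold y = lam (app (var here) (app (con y) (var here)))

θᶜ : ∀ {σ} → YConst σ → Tm YConst [] σ
θᶜ (Y σ) = unfold (Y σ)

θ : ∀ {Γ σ} → Tm YConst Γ σ → Tm YConst Γ σ
θ = cmap θᶜ

-- The occurrences of Y tagged new are the ones to be unfolded.
data Tagged : Ty → Set where
  old new : ∀ {σ} → YConst σ → Tagged σ

untagᶜ unfoldNewᶜ : ∀ {σ} → Tagged σ → Tm YConst [] σ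
untagᶜ (old y) = con y
untagᶜ (new y) = con y
unfoldNewᶜ (old y) = con y
unfoldNewᶜ (new y) = θᶜ y

untag unfoldNew : ∀ {Γ σ} → Tm Tagged Γ σ → Tm YConst Γ σ
untag     = cmap untagᶜ
unfoldNew = cmap unfoldNewᶜ

infix 3 _⇛_
-- Parallel unfolding of chosen occurrences of `Y`, taken modulo βη so that only the unfoldings
-- count as steps. Both ends are images of one tagged term, which reduces diagrams of steps to
-- equations between constant replacements.
record _⇛_ {Γ σ} (M N : Tm YConst Γ σ) : Set where
  constructor tagging
  field
    skeleton : Tm Tagged Γ σ
    source   : M ≈ untag skeleton
    target   : N ≈ unfoldNew skeleton

≈⇒⇛ : ∀ {Γ σ} {M N : Tm YConst Γ σ} → M ≈ N → M ⇛ N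
≈⇒⇛ {N = N} p = tagging (cmap (λ c → con (old c)) N)
  (c-trans p (≡⇒Conv (sym (trans (cmap-∘ (λ _ → refl) N) (cmap-id N)))))
  (≡⇒Conv (sym (trans (cmap-∘ (λ _ → refl) N) (cmap-id N))))

⇛-lam : ∀ {Γ σ τ} {M N : Tm YConst (σ ∷ Γ) τ} → M ⇛ N → lam M ⇛ lam N
⇛-lam (tagging T p q) = tagging (lam T) (c-lam p) (c-lam q)

⇛-app : ∀ {Γ σ τ} {M M' : Tm YConst Γ (σ ⇒ τ)} {N N'} → M ⇛ M' → N ⇛ N' → app M N ⇛ app M' N'
⇛-app (tagging T p q) (tagging T' p' q') = tagging (app T T') (c-app p p') (c-app q q')

⇛-unfold : ∀ {Γ σ} (f : Tm YConst Γ (σ ⇒ σ)) → app (con (Y σ)) f ⇛ app f (app (con (Y σ)) f)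
⇛-unfold {σ = σ} f with ≈⇒⇛ {M = f} c-refl
... | tagging T p q = tagging (app (con (new (Y σ))) T) (c-app c-refl p)
  (c-trans (c-app q (c-app c-refl q)) (c-sym (c-β _ _)))

cmap-square : ∀ {C C₁ C₂ C'} {s₁ : ∀ {σ} → C σ → Tm C₁ [] σ} {s₂ : ∀ {σ} → C₁ σ → Tm C' [] σ}
              {t₁ : ∀ {σ} → C σ → Tm C₂ [] σ} {t₂ : ∀ {σ} → C₂ σ → Tm C' [] σ} →
              (∀ {σ} (c : C σ) → cmap s₂ (s₁ c) ≡ cmap t₂ (t₁ c)) →
              ∀ {Γ σ} (M : Tm C Γ σ) → cmap s₂ (cmap s₁ M) ≡ cmap t₂ (cmap t₁ M)
cmap-square {t₁ = t₁} {t₂} h M =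
  trans (cmap-∘ {t = λ c → cmap t₂ (t₁ c)} h M) (sym (cmap-∘ (λ _ → refl) M))

⇛-θ : ∀ {Γ σ} {M N : Tm YConst Γ σ} → M ⇛ N → θ M ⇛ θ N
⇛-θ (tagging T p q) = tagging (cmap t T)
  (c-trans (cmap-≈ θᶜ p) (≡⇒Conv (cmap-square untag-t T)))
  (c-trans (cmap-≈ θᶜ q) (≡⇒Conv (cmap-square unfoldNew-t T)))
  where
  t : ∀ {σ} → Tagged σ → Tm Tagged [] σ
  -- Every occurrence is unfolded once, and the copy of `Y` inside inherits its tag.
  t (old (Y σ)) = unfold (old (Y σ))
  t (new (Y σ)) = unfold (new (Y σ))
  untag-t : ∀ {σ} (c : Tagged σ) → cmap θᶜ (untagᶜ c) ≡ cmap untagᶜ (t c)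
  untag-t (old (Y σ)) = refl
  untag-t (new (Y σ)) = refl
  unfoldNew-t : ∀ {σ} (c : Tagged σ) → cmap θᶜ (unfoldNewᶜ c) ≡ cmap unfoldNewᶜ (t c)
  unfoldNew-t (old (Y σ)) = refl
  unfoldNew-t (new (Y σ)) = refl

-- Takahashi's triangle. In `N` the `new` occurrences are already unfolded, so what remains to be
-- done to reach `θ M` is to unfold the `old` ones: these become `new`, and the `Y` inside an
-- unfolded one becomes `old`.
⇛-develop : ∀ {Γ σ} {M N : Tm YConst Γ σ} → M ⇛ N → N ⇛ θ M
⇛-develop (tagging T p q) = tagging (cmap t T)
  (c-trans q (≡⇒Conv (sym (cmap-∘ untag-t T))))
  (c-trans (cmap-≈ θᶜ p) (≡⇒Conv (cmap-square unfoldNew-t T)))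
  where
  t : ∀ {σ} → Tagged σ → Tm Tagged [] σ
  t (old y)     = con (new y)
  t (new (Y σ)) = unfold (old (Y σ))
  untag-t : ∀ {σ} (c : Tagged σ) → cmap untagᶜ (t c) ≡ unfoldNewᶜ c
  untag-t (old (Y σ)) = refl
  untag-t (new (Y σ)) = refl
  unfoldNew-t : ∀ {σ} (c : Tagged σ) → cmap θᶜ (untagᶜ c) ≡ cmap unfoldNewᶜ (t c)
  unfoldNew-t (old (Y σ)) = refl
  unfoldNew-t (new (Y σ)) = refl

Conv⇒zigzag : ∀ {Γ σ} {M N : Tm YConst Γ σ} → Conv YConst YAx M N → EqClosure _⇛_ M N
Conv⇒zigzag c-refl        = nil
Conv⇒zigzag (c-sym p)     = EqC.symmetric _⇛_ (Conv⇒zigzag p)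
Conv⇒zigzag (c-trans p q) = Conv⇒zigzag p ◅◅ Conv⇒zigzag q
Conv⇒zigzag (c-lam p)     = EqC.gmap lam ⇛-lam (Conv⇒zigzag p)
Conv⇒zigzag (c-app {M' = M'} {N = N} p q) =
  EqC.gmap (λ K → app K N) (λ r → ⇛-app r (≈⇒⇛ c-refl)) (Conv⇒zigzag p) ◅◅
  EqC.gmap (app M') (λ r → ⇛-app (≈⇒⇛ c-refl) r) (Conv⇒zigzag q)
Conv⇒zigzag (c-β M N)       = fwd (≈⇒⇛ (c-β M N)) ◅ nil
Conv⇒zigzag (c-η M)         = fwd (≈⇒⇛ (c-η M)) ◅ nil
Conv⇒zigzag (c-ax (y-ax f)) = bwd (⇛-unfold f) ◅ nil

-- Tags do not affect the value at bottom, so the skeleton itself is total and hence convertible to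
-- a constant-free `Q` with its tagged constants kept free. Untagging and unfolding then both give
-- `Q`.
pure-⇛ : ∀ {σ} (P : Tm NoConst [] σ) {M N : Tm YConst [] σ} → M ≈ embed P → M ⇛ N → N ≈ embed P
pure-⇛ {σ} P h (tagging T p q) =
  c-trans (through unfoldNewᶜ q) (c-trans (c-sym (through untagᶜ p)) h)
  where
  untag⊥ : ∀ {υ} (c : Tagged υ) → υ ⊢ ⟦ untagᶜ c ⟧⊥ ≃ ⊥ᴰ υ
  untag⊥ {υ} (old y) = ≃-refl υ
  untag⊥ {υ} (new y) = ≃-refl υ
  total-T : total σ ⟦ T ⟧⊥ ≡ true
  total-T = trans (sym (total-cmap untag⊥ T)) (trans (total-Conv _ (λ _ ()) (c-trans (c-sym p) h)) (pure⇒total _ P))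
  Q : Tm NoConst [] σ
  Q = proj₁ (total⇒pure T total-T)
  through : ∀ (s : ∀ {τ} → Tagged τ → Tm YConst [] τ) {K} → K ≈ cmap s T → K ≈ embed Q
  through s e = c-trans e (c-trans (cmap-≈ s (proj₂ (total⇒pure T total-T))) (≡⇒Conv (cmap-embed s Q)))

θ^ : ∀ {Γ σ} → ℕ → Tm YConst Γ σ → Tm YConst Γ σ
θ^ zero    M = M
θ^ (suc n) M = θ^ n (θ M)

⇛-θ^ : ∀ {Γ σ} n {M N : Tm YConst Γ σ} → M ⇛ N → θ^ n M ⇛ θ^ n N
⇛-θ^ zero    p = p
⇛-θ^ (suc n) p = ⇛-θ^ n (⇛-θ p)

θ^-embed : ∀ {Γ σ} n (P : Tm NoConst Γ σ) → θ^ n (embed P) ≡ embed P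
θ^-embed zero    P = refl
θ^-embed (suc n) P = trans (cong (θ^ n) (cmap-embed θᶜ P)) (θ^-embed n P)

UnfoldsTo : ∀ {σ} → Tm NoConst [] σ → Tm YConst [] σ → Set
UnfoldsTo P M = ∃[ n ] θ^ n M ≈ embed P

UnfoldsTo-zigzag : ∀ {σ} (P : Tm NoConst [] σ) {M N} → EqClosure _⇛_ M N → UnfoldsTo P M → UnfoldsTo P N
UnfoldsTo-zigzag P nil         u       = u
UnfoldsTo-zigzag P (fwd p ◅ z) (n , h) = UnfoldsTo-zigzag P z (n , pure-⇛ P h (⇛-θ^ n p))
-- Against the direction of a step, the triangle leads from the current term to `θ` of the next one,
-- at the price of one more unfolding.
UnfoldsTo-zigzag P (bwd p ◅ z) (n , h) =
  UnfoldsTo-zigzag P z (suc n , pure-⇛ P h (⇛-θ^ n (⇛-develop p)))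

-- Being unfoldable to `P` is carried along the zigzag from `embed P` to `embed Q`, and `θ` fixes
-- the latter.
Y-conservative : ∀ {σ} (P Q : Tm NoConst [] σ) → Conv YConst YAx (embed P) (embed Q) →
                 embed {YConst} P ≈ embed Q
Y-conservative P Q p with UnfoldsTo-zigzag P (Conv⇒zigzag p) (0 , c-refl)
... | n , h = c-sym (c-trans (≡⇒Conv (sym (θ^-embed n Q))) h)

-- Numerals

rename-iterApp : ∀ {C Γ Δ α} (ρ : ∀ {σ} → Γ ∋ σ → Δ ∋ σ) n (f : Tm C Γ (α ⇒ α)) x →
                 rename ρ (iterApp n f x) ≡ iterApp n (rename ρ f) (rename ρ x)
rename-iterApp ρ zero    f x = refl
rename-iterApp ρ (suc n) f x = cong (app _) (rename-iterApp ρ n f x)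

csub-iterApp : ∀ {C C' Γ Δ α} (s : ∀ {σ} → C σ → Tm C' Δ σ) (r : ∀ {σ} → Γ ∋ σ → Tm C' Δ σ) n
               (f : Tm C Γ (α ⇒ α)) x → csub s r (iterApp n f x) ≡ iterApp n (csub s r f) (csub s r x)
csub-iterApp s r zero    f x = refl
csub-iterApp s r (suc n) f x = cong (app _) (csub-iterApp s r n f x)

rename-numeral : ∀ {C Γ Δ} (ρ : ∀ {σ} → Γ ∋ σ → Δ ∋ σ) α n → rename ρ (numeral {C} α n) ≡ numeral α n
rename-numeral ρ α n = cong (λ M → lam (lam M)) (rename-iterApp _ n _ _)

csub-numeral : ∀ {C C' : Ty → Set} {Γ Δ} (s : ∀ {σ} → C σ → Tm C' Δ σ) (r : ∀ {σ} → Γ ∋ σ → Tm C' Δ σ) α n →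
               csub s r (numeral α n) ≡ numeral α n
csub-numeral s r α n = cong (λ M → lam (lam M))
  (csub-iterApp (λ c → weaken (weaken (s c))) (extS (extS r)) n _ _)

cmap-numeral : ∀ {C C' : Ty → Set} (s : ∀ {σ} → C σ → Tm C' [] σ) {Γ} α n →
               cmap s (numeral {C} {Γ} α n) ≡ numeral α n
cmap-numeral s α n = trans (cmap-csub s (numeral α n)) (csub-numeral (λ c → rename ε (s c)) var α n)

cmap-applyNumerals : ∀ {C C' : Ty → Set} (s : ∀ {σ} → C σ → Tm C' [] σ) {k} (αs : Vec Ty k) {α} F ms →
                     cmap s (applyNumerals αs {α} F ms) ≡ applyNumerals αs (cmap s F) ms
cmap-applyNumerals s []       F []       = refl
cmap-applyNumerals s (β ∷ αs) F (m ∷ ms) = trans (cmap-applyNumerals s αs (app F (numeral β m)) ms)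
  (cong (λ N → applyNumerals αs (app (cmap s F) N) ms) (cmap-numeral s β m))

applyNumerals-Conv : ∀ {C} {Ax : Axioms C} {k} (αs : Vec Ty k) {α} {F G : Tm C [] (Arr αs α)} ms →
                     Conv C Ax F G → Conv C Ax (applyNumerals αs F ms) (applyNumerals αs G ms)
applyNumerals-Conv []       []       p = p
applyNumerals-Conv (β ∷ αs) (m ∷ ms) p = applyNumerals-Conv αs ms (c-app p c-refl)

-- Bounding the recursion depth

boundᶜ : ∀ {σ} → YConst σ → Tm YConst [] σ
boundᶜ (Y σ) = lam (iterApp (height σ) (var here) (app (con (Y σ)) (var here)))

bound : ∀ {Γ σ} → Tm YConst Γ σ → Tm YConst Γ σ
bound = cmap boundᶜ

iterApp-Y : ∀ {Γ σ} n {f : Tm YConst Γ (σ ⇒ σ)} →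
            Conv YConst YAx (iterApp n f (app (con (Y σ)) f)) (app (con (Y σ)) f)
iterApp-Y zero    = c-refl
iterApp-Y (suc n) = c-trans (c-app c-refl (iterApp-Y n)) (c-ax (y-ax _))

bound-Conv : ∀ {Γ σ} (M : Tm YConst Γ σ) → Conv YConst YAx (bound M) M
bound-Conv (var x)     = c-refl
bound-Conv (con (Y σ)) = c-trans (≡⇒Conv (cong lam (rename-iterApp _ (height σ) _ _)))
  (c-trans (c-lam (iterApp-Y (height σ))) (c-η _))
bound-Conv (lam M)     = c-lam (bound-Conv M)
bound-Conv (app M N)   = c-app (bound-Conv M) (bound-Conv N)

-- Since h iterations from bottom reach a fixed point, this interpretation satisfies the axiom of
-- `Y`, although it is the value of a term whose own `Y` denotes bottom.
⟦Y⟧ : ∀ {σ} → YConst σ → D σ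
⟦Y⟧ c = ⟦ boundᶜ c ⟧⊥

⟦Y⟧-iter : ∀ σ (f : D (σ ⇒ σ)) → σ ⊢ proj₁ (⟦Y⟧ (Y σ)) f ≃ iterᴰ σ f (height σ)
⟦Y⟧-iter σ f = go (height σ)
  where
  go : ∀ n → σ ⊢ eval (λ {υ} (_ : YConst υ) → ⊥ᴰ υ) (_▸_ {D} ∅ f)
                   (iterApp n (var here) (app (con (Y σ)) (var here))) ≃ iterᴰ σ f n
  go zero    = ≃-refl σ
  go (suc n) = proj₂ f (proj₁ (go n)) , proj₂ f (proj₂ (go n))

⟦Y⟧-sound : ∀ {Γ σ} {M N : Tm YConst Γ σ} (e : Env Γ) → YAx M N → σ ⊢ eval ⟦Y⟧ e M ≃ eval ⟦Y⟧ e N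
⟦Y⟧-sound {σ = σ} e (y-ax f) =
  ≃-trans σ (proj₂ φ (proj₁ i) , proj₂ φ (proj₂ i)) (≃-trans σ (iterᴰ-fixed σ φ) (≃-sym σ i))
  where
  φ = eval ⟦Y⟧ e f
  i = ⟦Y⟧-iter σ φ

numeral-total : ∀ {C : Ty → Set} (I : ∀ {σ} → C σ → D σ) α n →
                total (ω α) (eval I ∅ (numeral α n)) ≡ true
numeral-total I α n = trans (cong (λ M → total (ω α) (eval I ∅ M)) (sym (cmap-numeral noConst α n)))
  (pure⇒total I (numeral α n))

-- The value of `bound M` at bottom is that of `M` under `⟦Y⟧`, which λY-conversion preserves. So
-- `bound M` is total and has a constant-free form `P`; in λY this equals the numeral, and
-- conservativity removes the axioms.
bound-numeral : ∀ {α} (M : Tm YConst [] (ω α)) n →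
                Conv YConst YAx M (numeral α n) → bound M ≈ numeral α n
bound-numeral {α} M n p = c-trans q
  (c-trans (Y-conservative P (numeral α n) P=n) (≡⇒Conv (cmap-numeral noConst α n)))
  where
  bound-total : total (ω α) ⟦ bound M ⟧⊥ ≡ true
  bound-total = trans (total-cmap (λ {υ} _ → ≃-refl υ) M)
    (trans (total-Conv ⟦Y⟧ ⟦Y⟧-sound p) (numeral-total ⟦Y⟧ α n))
  P = proj₁ (total⇒pure (bound M) bound-total)
  q = proj₂ (total⇒pure (bound M) bound-total)
  P=n : Conv YConst YAx (embed P) (embed (numeral α n))
  P=n = c-trans (≈⇒Conv (c-sym q)) (c-trans (bound-Conv M)
    (c-trans p (≡⇒Conv (sym (cmap-numeral noConst α n)))))

-- λΩ-definability

Ω-at : ∀ σ {Γ} → Tm OmegaConst Γ σ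
Ω-at o       = con Ω
Ω-at (σ ⇒ τ) = lam (Ω-at τ)

eval-Ω-at : ∀ σ {Γ} (e : Env Γ) → σ ⊢ eval (λ {υ} _ → ⊥ᴰ υ) e (Ω-at σ) ≃ ⊥ᴰ σ
eval-Ω-at o       e = ≃-refl o
eval-Ω-at (σ ⇒ τ) e = (λ d → proj₁ (eval-Ω-at τ (_▸_ {D} e d))) , (λ d → proj₂ (eval-Ω-at τ (_▸_ {D} e d)))

Y⇒Ωᶜ : ∀ {σ} → YConst σ → Tm OmegaConst [] σ
Y⇒Ωᶜ {σ} _ = Ω-at σ

-- A closed ground term of λY, by which conversions in λΩ are translated back.
Ω⇒Yᶜ : ∀ {σ} → OmegaConst σ → Tm YConst [] σ
Ω⇒Yᶜ Ω = app (con (Y o)) (lam (var here))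

-- `Ω-at` denotes bottom, as does the free `Y`. So totality passes back from the Ω-term to
-- `bound M`, whose constant-free form survives both translations.
Ω-numeral⇒Y-numeral : ∀ {α} (M : Tm YConst [] (ω α)) n →
  Conv OmegaConst OmegaAx (cmap Y⇒Ωᶜ (bound M)) (numeral α n) → Conv YConst YAx M (numeral α n)
Ω-numeral⇒Y-numeral {α} M n p = c-trans (c-sym (bound-Conv M)) (c-trans (≈⇒Conv q)
    (c-trans (≡⇒Conv (sym (cmap-embed Ω⇒Yᶜ P)))
      (c-trans (cmap-Conv (λ ()) Ω⇒Yᶜ P=n) (≡⇒Conv (cmap-numeral Ω⇒Yᶜ α n)))))
  where
  bound-total : total (ω α) ⟦ bound M ⟧⊥ ≡ true
  bound-total = trans (sym (total-cmap (λ {υ} _ → eval-Ω-at υ ∅) (bound M)))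
    (trans (total-Conv _ (λ _ ()) p) (numeral-total (λ {υ} _ → ⊥ᴰ υ) α n))
  P = proj₁ (total⇒pure (bound M) bound-total)
  q = proj₂ (total⇒pure (bound M) bound-total)
  P=n : Conv OmegaConst OmegaAx (embed P) (numeral α n)
  P=n = c-trans (≡⇒Conv (sym (cmap-embed Y⇒Ωᶜ P))) (c-trans (cmap-≈ Y⇒Ωᶜ (c-sym q)) p)

Y-definable⇒Ω-definable : ∀ {k} (αs : Vec Ty k) α (f : PartialFun k) →
  Definable YConst YAx αs α f → Definable OmegaConst OmegaAx αs α f
Y-definable⇒Ω-definable αs α f (F , d) = cmap Y⇒Ωᶜ (bound F) , λ ms m →
  (λ g → c-trans (≡⇒Conv (sym (commute ms))) (c-trans
    (cmap-≈ Y⇒Ωᶜ (bound-numeral (applyNumerals αs F ms) m (proj₁ (d ms m) g)))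
    (≡⇒Conv (cmap-numeral Y⇒Ωᶜ α m)))) ,
  λ p → proj₂ (d ms m) (Ω-numeral⇒Y-numeral _ m (c-trans (≡⇒Conv (commute ms)) p))
  where
  commute : ∀ ms → cmap Y⇒Ωᶜ (bound (applyNumerals αs F ms)) ≡ applyNumerals αs (cmap Y⇒Ωᶜ (bound F)) ms
  commute ms = trans (cong (cmap Y⇒Ωᶜ) (cmap-applyNumerals boundᶜ αs F ms))
    (cmap-applyNumerals Y⇒Ωᶜ αs (bound F) ms)

-- Definability in the pure calculus

module _ {C : Ty → Set} where

  -- Application of terms that depend on a parameter of type `υ`. In `glue` the parameter is the
  -- ground term from which the replacements of `Y` are built.
  applyUnder : ∀ {Γ υ σ τ} → Tm C Γ (υ ⇒ σ ⇒ τ) → Tm C Γ σ → Tm C Γ (υ ⇒ τ)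
  applyUnder M N = lam (app (app (weaken M) (var here)) (weaken N))

  -- λ z̄. M (x z̄) z̄ : a ground-type argument for M can always be built from x and the z̄.
  fill : ∀ α {Γ} → Tm C Γ (o ⇒ α) → Tm C Γ α → Tm C Γ α
  fill o       M x = app M x
  fill (α ⇒ β) M x = lam (fill β (applyUnder (weaken M) (var here)) (app (weaken x) (var here)))

  -- λ n̄ f x z̄. M (x z̄) n̄ f x z̄
  glue : ∀ {k} (αs : Vec Ty k) {α Γ} → Tm C Γ (o ⇒ Arr αs α) → Tm C Γ (Arr αs α)
  glue []       {α} M =
    lam (lam (fill α (applyUnder (applyUnder (weaken (weaken M)) (var (there here))) (var here)) (var here)))
  glue (β ∷ αs) M = lam (glue αs (applyUnder (weaken M) (var here)))

  csub-applyUnder : ∀ {Γ Δ υ σ τ} (s : ∀ {σ} → C σ → Tm C Δ σ) (r : ∀ {σ} → Γ ∋ σ → Tm C Δ σ)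
                    (M : Tm C Γ (υ ⇒ σ ⇒ τ)) N →
                    csub s r (applyUnder M N) ≡ applyUnder (csub s r M) (csub s r N)
  csub-applyUnder s r M N =
    cong₂ (λ M N → lam (app (app M (var here)) N)) (csub-weaken s r M) (csub-weaken s r N)

  csub-applyUnder-weaken : ∀ {Γ Δ υ σ τ} (s : ∀ {σ} → C σ → Tm C Δ σ) (r : ∀ {σ} → Γ ∋ σ → Tm C Δ σ)
    (M : Tm C Γ (υ ⇒ σ ⇒ τ)) →
    csub (λ c → weaken (s c)) (extS r) (applyUnder (weaken M) (var here)) ≡ applyUnder (weaken (csub s r M)) (var here)
  csub-applyUnder-weaken s r M = trans (csub-applyUnder (λ c → weaken (s c)) (extS r) (weaken M) (var here))
    (cong (λ K → applyUnder K (var here)) (csub-weaken s r M))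

  csub-fill : ∀ α {Γ Δ} (s : ∀ {σ} → C σ → Tm C Δ σ) (r : ∀ {σ} → Γ ∋ σ → Tm C Δ σ) M x →
              csub s r (fill α M x) ≡ fill α (csub s r M) (csub s r x)
  csub-fill o       s r M x = refl
  csub-fill (α ⇒ β) s r M x = cong lam (trans (csub-fill β (λ c → weaken (s c)) (extS r) _ _)
    (cong₂ (fill β) (csub-applyUnder-weaken s r M) (cong (λ K → app K (var here)) (csub-weaken s r x))))

  csub-glue : ∀ {k} (αs : Vec Ty k) {α Γ Δ} (s : ∀ {σ} → C σ → Tm C Δ σ) (r : ∀ {σ} → Γ ∋ σ → Tm C Δ σ) M →
              csub s r (glue αs {α} M) ≡ glue αs (csub s r M)
  csub-glue []       {α} s r M = cong (λ K → lam (lam K)) (trans (csub-fill α s₂ r₂ _ _)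
    (cong (λ K → fill α K (var here))
      (trans (csub-applyUnder s₂ r₂ (applyUnder (weaken (weaken M)) (var (there here))) (var here))
        (cong (λ K → applyUnder K (var here))
          (trans (csub-applyUnder s₂ r₂ (weaken (weaken M)) (var (there here)))
            (cong (λ K → applyUnder K (var (there here)))
              (trans (csub-weaken (λ c → weaken (s c)) (extS r) (weaken M)) (cong weaken (csub-weaken s r M)))))))))
    where
    s₂ : ∀ {σ} → C σ → Tm C _ σ
    s₂ c = weaken (weaken (s c))
    r₂ : ∀ {σ} → _ ∋ σ → Tm C _ σ
    r₂ = extS (extS r)
  csub-glue (β ∷ αs) s r M = cong lam (trans (csub-glue αs (λ c → weaken (s c)) (extS r) _)
    (cong (glue αs) (csub-applyUnder-weaken s r M)))

  applyUnder-≈ : ∀ {Γ υ σ τ} {M M' : Tm C Γ (υ ⇒ σ ⇒ τ)} N → M ≈ M' → applyUnder M N ≈ applyUnder M' N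
  applyUnder-≈ N p = c-lam (c-app (c-app (rename-≈ there p) c-refl) c-refl)

  applyUnder-lam : ∀ {Γ υ σ τ} (M : Tm C (υ ∷ Γ) (σ ⇒ τ)) N → applyUnder (lam M) N ≈ lam (app M (weaken N))
  applyUnder-lam M N = c-lam (c-app (β-≡ (trans ([]-csub (rename _ M) _) (trans (csub-rename _ _ _ M)
    (trans (csub-cong (λ _ → refl) (λ { here → refl ; (there x) → refl }) M) (csub-id M))))) c-refl)

  -- When `M` is a constant function of the parameter, the ground term supplied disappears by β and
  -- the abstractions over the z̄ contract by η.
  fill-const : ∀ α {Γ} {M : Tm C Γ (o ⇒ α)} (N : Tm C Γ α) x → M ≈ lam (weaken N) → fill α M x ≈ N
  fill-const o       N x p = c-trans (c-app p c-refl) (β-≡ (weaken-[] N x))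
  fill-const (α ⇒ β) N x p = c-trans
    (c-lam (fill-const β (app (weaken N) (var here)) _ (c-trans (applyUnder-≈ _ (rename-≈ there p))
      (c-trans (applyUnder-lam _ _) (c-lam (c-app (≡⇒Conv (rename-extR-weaken there N)) c-refl))))))
    (c-η N)

  glue-const : ∀ {α} {M : Tm C [] (o ⇒ ω α)} n → M ≈ lam (numeral α n) → glue [] M ≈ numeral α n
  glue-const {α} {M} n p = c-trans
    (c-lam (c-lam (fill-const α (app (app (weaken (weaken (numeral α n))) (var (there here))) (var here)) _
      (c-trans
        (applyUnder-≈ _ (c-trans (applyUnder-≈ _ weakened) (applyUnder-lam _ _))) (applyUnder-lam _ _)))))
    (c-trans (c-lam (c-η (app (weaken (numeral α n)) (var here)))) (c-η (numeral α n)))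
    where
    num = numeral {C} α n
    weakened : weaken (weaken M) ≈ lam (weaken (weaken (weaken num)))
    weakened = c-trans (rename-≈ there (rename-≈ there p)) (≡⇒Conv (cong lam (trans
      (trans (cong (rename _) (rename-numeral _ α n)) (rename-numeral _ α n))
      (sym (trans (cong (λ K → weaken (weaken K)) (rename-numeral there α n))
        (trans (cong weaken (rename-numeral there α n)) (rename-numeral there α n)))))))

  glue-app : ∀ {k} (αs : Vec Ty k) {α β} (M : Tm C [] (o ⇒ ω β ⇒ Arr αs α)) N →
             app (glue (β ∷ αs) M) N ≈ glue αs (applyUnder M N)
  glue-app αs M N = β-≡ (trans ([]-csub (glue αs _) N) (trans (csub-glue αs con (_▸_ {Tm C []} var N) _) (cong (glue αs)
    (trans (csub-applyUnder con (_▸_ {Tm C []} var N) (weaken M) (var here))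
      (cong (λ K → applyUnder K N) (csub-▸-weaken M N))))))

const-at : ∀ σ {Γ} → Tm NoConst Γ o → Tm NoConst Γ σ
const-at o       M = M
const-at (σ ⇒ τ) M = lam (const-at τ (weaken M))

Y⇒constᶜ : ∀ {σ} → YConst σ → Tm NoConst (o ∷ []) σ
Y⇒constᶜ {σ} _ = const-at σ (var here)

abstractY : ∀ {σ} → Tm YConst [] σ → Tm NoConst (o ∷ []) σ
abstractY = csub Y⇒constᶜ (λ ())

-- `M` is fixed only up to conversion because each numeral turns it into an `applyUnder`, which is
-- merely convertible to an abstraction of the required form.
glue-applyNumerals : ∀ {k} (αs : Vec Ty k) {α} (F : Tm YConst [] (Arr αs α)) ms {M} → M ≈ lam (abstractY F) →
  ∃[ M' ] applyNumerals αs (glue αs M) ms ≈ glue [] M' × M' ≈ lam (abstractY (applyNumerals αs F ms))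
glue-applyNumerals []       F []       p = _ , c-refl , p
glue-applyNumerals (β ∷ αs) F (m ∷ ms) {M} p
  with glue-applyNumerals αs (app F (numeral β m)) ms {applyUnder M (numeral β m)}
    (c-trans (applyUnder-≈ (numeral β m) p) (c-trans (applyUnder-lam (abstractY F) (numeral β m))
      (c-lam (c-app c-refl (≡⇒Conv (trans (rename-numeral there β m) (sym (csub-numeral Y⇒constᶜ (λ ()) β m))))))))
... | M' , q , r = M' , c-trans (applyNumerals-Conv αs ms (glue-app αs M (numeral β m))) q , r

Y-definable⇒definable : ∀ {k} (αs : Vec Ty k) α (f : Vec ℕ k → ℕ) →
  Definable YConst YAx αs α (totalGraph f) → Definable NoConst NoAx αs α (totalGraph f)
Y-definable⇒definable αs α f (F , d) = G , λ ms m →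
  (λ { refl → ≈⇒Conv (G-value ms) }) ,
  -- Distinctness of numerals is not proved separately: `p` identifies the numerals of `f ms` and
  -- `m`, so in λY the term `F` on `ms` also equals the numeral of `m`, and definability by `F`
  -- gives the equation.
  λ p → proj₂ (d ms m) (c-trans (proj₁ (d ms (f ms)) refl)
    (c-trans (≡⇒Conv (sym (cmap-numeral noConst α (f ms))))
      (c-trans (cmap-Conv (λ ()) noConst (c-trans (c-sym (≈⇒Conv (G-value ms))) p))
        (≡⇒Conv (cmap-numeral noConst α m)))))
  where
  G : Tm NoConst [] (Arr αs α)
  G = glue αs (lam (abstractY (bound F)))
  bound-value : ∀ ms → applyNumerals αs (bound F) ms ≈ numeral α (f ms)
  bound-value ms = c-trans (≡⇒Conv (sym (cmap-applyNumerals boundᶜ αs F ms)))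
    (bound-numeral (applyNumerals αs F ms) (f ms) (proj₁ (d ms (f ms)) refl))
  G-value : ∀ ms → applyNumerals αs G ms ≈ numeral α (f ms)
  G-value ms with glue-applyNumerals αs (bound F) ms c-refl
  ... | M' , q , r = c-trans q (glue-const (f ms) (c-trans r (c-lam
    (c-trans (csub-Conv (λ ()) Y⇒constᶜ (λ ()) (bound-value ms)) (≡⇒Conv (csub-numeral Y⇒constᶜ (λ ()) α (f ms)))))))

theorem1 : ∀ {k : ℕ} (αs : Vec Ty k) (α : Ty) →
    (∀ (f : PartialFun k) →
       Definable YConst YAx αs α f → Definable OmegaConst OmegaAx αs α f) ×
    (∀ (f : Vec ℕ k → ℕ) →
       Definable YConst YAx αs α (totalGraph f) → Definable NoConst NoAx αs α (totalGraph f))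
theorem1 αs α = Y-definable⇒Ω-definable αs α , Y-definable⇒definable αs α
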